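{- Let $r \ge 2$ be an integer. Suppose that $G$ is an $n$-vertex $K_{r+1}$-free graph satisfying $$\delta(G) > \min\left\{ \frac{3r-4}{3r-2}\,n - \frac{\Delta(G)}{3r-2},~ n - \frac{\Delta(G)+1}{r-1} \right\}.$$ Then $G$ is $r$-partite.
   Context: All graphs are finite and simple. $K_{r+1}$ denotes the complete graph on $r+1$ vertices; $G$ is $K_{r+1}$-free if it contains no copy of $K_{r+1}$ as a subgraph. $\delta(G)$ and $\Delta(G)$ denote the minimum and maximum degree of $G$. A graph is $r$-partite if its vertex set can be partitioned into $r$ (possibly empty) independent sets. -}

module Defs where

open import Data.Nat using (ℕ; zero; suc; _+_; _⊔_; _⊓_)
open import Data.Bool using (Bool; true; false; if_then_else_)
open import Data.Fin using (Fin)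
open import Data.List using (List; []; _∷_; map; foldr)
open import Data.Nat.ListAction using (sum)
open import Data.List.Base using (allFin)
open import Data.Product using (Σ; _×_)
open import Function.Definitions using (Injective)
open import Relation.Binary.PropositionalEquality using (_≡_; _≢_)
open import Relation.Nullary using (¬_)

record Graph (n : ℕ) : Set where
  field
    adj     : Fin n → Fin n → Bool
    sym     : ∀ u v → adj u v ≡ adj v u
    irrefl  : ∀ v → adj v v ≡ false

open Graph public

E : ∀ {n} → Graph n → Fin n → Fin n → Set
E G u v = adj G u v ≡ true

degree : ∀ {n} → Graph n → Fin n → ℕ
degree {n} G v = sum (map (λ w → if adj G v w then 1 else 0) (allFin n))

maxDegree : ∀ {n} → Graph n → ℕ
maxDegree {n} G = foldr (λ v m → degree G v ⊔ m) 0 (allFin n)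

minDegree : ∀ {n} → Graph n → ℕ
minDegree {zero}  G = 0
minDegree {suc n} G = foldr (λ v m → degree G v ⊓ m) (degree G Fin.zero) (allFin (suc n))

ContainsClique : ∀ {n} → Graph n → ℕ → Set
ContainsClique {n} G k =
  Σ (Fin k → Fin n) λ f → Injective _≡_ _≡_ f × (∀ i j → i ≢ j → E G (f i) (f j))

CliqueFree : ∀ {n} → Graph n → ℕ → Set
CliqueFree G k = ¬ ContainsClique G k

-- r-partite: V(G) splits into r (possibly empty) independent sets,
-- i.e. there is a colouring Fin n → Fin r with no edge inside a class
Partite : ∀ {n} → Graph n → ℕ → Set
Partite {n} G r = Σ (Fin n → Fin r) λ c → ∀ u v → E G u v → c u ≢ c v

{-# OPTIONS --safe #-}

-- The neighbourhood S of a vertex of maximum degree is K_r-free and has Δ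
-- vertices; enlarge S to a maximal K_r-free set, with complement T. Let every
-- vertex have at most s non-neighbours (itself included); |T| ≤ s.
-- If T is independent it gets a colour of its own, and S is (r−1)-colourable by
-- induction on r, applied with S ∩ N(u), u ∈ S, in the role of S.
-- Otherwise let xy be an edge in T. Maximality gives (r−1)-cliques K ∪ A in
-- S ∩ N(x) and K ∪ B in S ∩ N(y); choose them with K as large as possible, and
-- put m = |A| = |B|, so m ≥ 1 since {x, y} ∪ K is not a K_{r+1}. Give the
-- vertices of K weight 3 and those of A, B, {x, y} weight 1. By K_{r+1}-freeness
-- every vertex of T misses weight at least 2, and a vertex w of S misses at least
-- 3, for otherwise it is joined to x, y, K and all but one vertex of A and of B,
-- and could be moved into K. Double counting the non-adjacencies yields
-- 3|S| + 2|T| ≤ (3|K| + 2m + 2) s ≤ (3r − 2) s, against the first degree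
-- condition. The second one reads (r − 1) s ≤ |S|, and already fails because
-- every vertex of S, and y as well, misses a vertex of the clique K ∪ A.
module Submission where

open import Defs
open import Data.Nat using (ℕ; _+_; _*_; _∸_; _≤_; _<_)
open import Data.Sum using (_⊎_)
open import Data.Bool using (true; false; if_then_else_)
open import Data.Bool.Properties using () renaming (_≟_ to _≟ᵇ_)
open import Data.Fin using (Fin; zero; suc)
open import Data.Fin.Properties using (suc-injective) renaming (_≟_ to _≟ᶠ_)
open import Data.List using (List; []; _∷_; _++_; length; map; filter; foldr; lookup)
open import Data.List.Base using (allFin)
open import Data.List.Membership.Propositional using (_∈_; find; lose)
open import Data.List.Membership.Propositional.Properties
  using (∈-filter⁺; ∈-filter⁻; ∈-allFin; ∈-∃++; ∈-++⁺ˡ; ∈-++⁺ʳ; ∈-++⁻; ∈-lookup)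
open import Data.List.Properties using (length-++; length-tabulate)
open import Data.List.Relation.Binary.Permutation.Propositional
  using (_↭_; ↭⇒↭ₛ; ↭-refl; ↭-sym; ↭-trans; prep)
open import Data.List.Relation.Binary.Permutation.Propositional.Properties
  using (∈-resp-↭; ↭-length; map⁺; shift; All-resp-↭)
import Data.List.Relation.Binary.Permutation.Setoid.Properties as Permutationₛ
open import Data.List.Relation.Unary.All as All using (All; []; _∷_; all?)
import Data.List.Relation.Unary.All.Properties as All
open import Data.List.Relation.Unary.AllPairs using (AllPairs; []; _∷_)
import Data.List.Relation.Unary.AllPairs.Properties as AllPairs
open import Data.List.Relation.Unary.Any using (any?; here; there)
open import Data.Nat using (zero; suc; z≤n; s≤s; s≤s⁻¹; pred; _⊔_; _⊓_; _≤?_)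
open import Data.Nat.ListAction using (sum)
open import Data.Nat.ListAction.Properties using (sum-↭)
open import Data.Nat.Properties hiding (suc-injective)
open import Data.Nat.Tactic.RingSolver using (solve-∀)
open import Data.Product using (_×_; _,_; proj₁; proj₂; ∃; Σ)
open import Data.Sum as Sum using (inj₁; inj₂)
open import Function using (_∘_)
open import Relation.Binary.PropositionalEquality
  using (_≡_; _≢_; refl; trans; cong; cong₂; subst; subst₂; resp₂; setoid; module ≡-Reasoning)
  renaming (sym to ≡-sym)
open import Relation.Nullary using (¬_; Dec; yes; no; contradiction)
open import Relation.Nullary.Decidable using (map′)
open import Relation.Unary using (Decidable)
open import Relation.Unary.Properties using (∁?)

-- Sums, partitions and extrema over lists.

module _ {A : Set} where

  sumOver : (A → ℕ) → List A → ℕ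
  sumOver f xs = sum (map f xs)

  sumOver-cong : ∀ {f g} → (∀ x → f x ≡ g x) → ∀ xs → sumOver f xs ≡ sumOver g xs
  sumOver-cong f≗g []       = refl
  sumOver-cong f≗g (x ∷ xs) = cong₂ _+_ (f≗g x) (sumOver-cong f≗g xs)

  sumOver-0 : ∀ xs → sumOver (λ _ → 0) xs ≡ 0
  sumOver-0 []       = refl
  sumOver-0 (x ∷ xs) = sumOver-0 xs

  sumOver-+ : ∀ f g xs → sumOver (λ x → f x + g x) xs ≡ sumOver f xs + sumOver g xs
  sumOver-+ f g []       = refl
  sumOver-+ f g (x ∷ xs) = begin
    f x + g x + sumOver (λ x → f x + g x) xs     ≡⟨ cong (f x + g x +_) (sumOver-+ f g xs) ⟩
    f x + g x + (sumOver f xs + sumOver g xs)    ≡⟨ interchange (f x) (g x) (sumOver f xs) (sumOver g xs) ⟩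
    (f x + sumOver f xs) + (g x + sumOver g xs)  ∎
    where
    open ≡-Reasoning
    interchange : ∀ a b c d → a + b + (c + d) ≡ (a + c) + (b + d)
    interchange = solve-∀

  sumOver-++ : ∀ f xs ys → sumOver f (xs ++ ys) ≡ sumOver f xs + sumOver f ys
  sumOver-++ f []       ys = refl
  sumOver-++ f (x ∷ xs) ys = trans (cong (f x +_) (sumOver-++ f xs ys)) (≡-sym (+-assoc (f x) _ _))

  sumOver-↭ : ∀ f {xs ys} → xs ↭ ys → sumOver f xs ≡ sumOver f ys
  sumOver-↭ f p = sum-↭ (map⁺ f p)

  sumOver-≤ : ∀ {f b xs} → All (λ x → f x ≤ b) xs → sumOver f xs ≤ length xs * b
  sumOver-≤ []         = z≤n
  sumOver-≤ (fx≤b ∷ p) = +-mono-≤ fx≤b (sumOver-≤ p)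

  sumOver-≥ : ∀ {f b xs} → All (λ x → b ≤ f x) xs → length xs * b ≤ sumOver f xs
  sumOver-≥ []         = z≤n
  sumOver-≥ (b≤fx ∷ p) = +-mono-≤ b≤fx (sumOver-≥ p)

  sumOver-∈ : ∀ f {x xs} → x ∈ xs → f x ≤ sumOver f xs
  sumOver-∈ f (here refl)          = m≤m+n _ _
  sumOver-∈ f (there {x = y} x∈xs) = ≤-trans (sumOver-∈ f x∈xs) (m≤n+m _ (f y))

  filter-∁-↭ : ∀ {P : A → Set} (P? : Decidable P) xs → xs ↭ filter P? xs ++ filter (∁? P?) xs
  filter-∁-↭ P? [] = ↭-refl
  filter-∁-↭ P? (x ∷ xs) with P? x
  ... | yes _ = prep x (filter-∁-↭ P? xs)
  ... | no  _ = ↭-trans (prep x (filter-∁-↭ P? xs)) (↭-sym (shift x (filter P? xs) _))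

  foldr-⊔-attained : A → ∀ (f : A → ℕ) xs → ∃ λ x → foldr (λ y m → f y ⊔ m) 0 xs ≤ f x
  foldr-⊔-attained x₀ f [] = x₀ , z≤n
  foldr-⊔-attained x₀ f (x ∷ xs) with foldr-⊔-attained x₀ f xs
  ... | y , max≤fy with ≤-total (f x) (f y)
  ...   | inj₁ fx≤fy = y , ⊔-lub fx≤fy max≤fy
  ...   | inj₂ fy≤fx = x , ⊔-lub ≤-refl (≤-trans max≤fy fy≤fx)

  foldr-⊓-≤ : ∀ (f : A → ℕ) e {x xs} → x ∈ xs → foldr (λ y m → f y ⊓ m) e xs ≤ f x
  foldr-⊓-≤ f e (here refl)          = m⊓n≤m _ _
  foldr-⊓-≤ f e (there {x = y} x∈xs) = ≤-trans (m⊓n≤n (f y) _) (foldr-⊓-≤ f e x∈xs)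

-- Counting non-adjacencies.

module _ {n : ℕ} (G : Graph n) where

  private
    V : Set
    V = Fin n

  E? : ∀ u → Decidable (E G u)
  E? u v = adj G u v ≟ᵇ true

  E-sym : ∀ {u v} → E G u v → E G v u
  E-sym {u} {v} = trans (sym G v u)

  E-irrefl : ∀ {v} → ¬ E G v v
  E-irrefl {v} e with trans (≡-sym e) (irrefl G v)
  ... | ()

  -- A vertex misses itself wherever it occurs in the list, and repetitions count, so repeating an
  -- entry raises its weight.
  missed : V → List V → ℕ
  missed u = sumOver (λ w → if adj G u w then 0 else 1)

  -- Double counting of non-adjacent pairs; symmetry of `adj` exchanges the roles.
  missed-swap : ∀ L W → sumOver (λ w → missed w L) W ≡ sumOver (λ u → missed u W) L
  missed-swap L [] = ≡-sym (sumOver-0 L)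
  missed-swap L (w ∷ W) = begin
    missed w L + sumOver (λ w → missed w L) W
      ≡⟨ cong₂ _+_ (sumOver-cong (λ u → cong (if_then 0 else 1) (sym G w u)) L) (missed-swap L W) ⟩
    sumOver (λ u → if adj G u w then 0 else 1) L + sumOver (λ u → missed u W) L
      ≡⟨ sumOver-+ _ _ L ⟨
    sumOver (λ u → missed u (w ∷ W)) L ∎
    where open ≡-Reasoning

  missed≡0⇒All : ∀ {u} L → missed u L ≡ 0 → All (E G u) L
  missed≡0⇒All         []      _  = []
  missed≡0⇒All {u = u} (w ∷ L) eq with adj G u w in uw
  ... | true = uw ∷ missed≡0⇒All L eq

  length-filter-E : ∀ u L → length (filter (E? u) L) + missed u L ≡ length L
  length-filter-E u [] = refl
  length-filter-E u (w ∷ L) with adj G u w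
  ... | true  = cong suc (length-filter-E u L)
  ... | false = trans (+-suc _ _) (cong suc (length-filter-E u L))

  length-filter-∁E : ∀ u L → length (filter (∁? (E? u)) L) ≡ missed u L
  length-filter-∁E u [] = refl
  length-filter-∁E u (w ∷ L) with adj G u w
  ... | true  = length-filter-∁E u L
  ... | false = cong suc (length-filter-∁E u L)

  degree+missed : ∀ u L → sumOver (λ w → if adj G u w then 1 else 0) L + missed u L ≡ length L
  degree+missed u [] = refl
  degree+missed u (w ∷ L) with adj G u w
  ... | true  = cong suc (degree+missed u L)
  ... | false = trans (+-suc _ _) (cong suc (degree+missed u L))

  -- Cliques inside a list of vertices.

  Clique : ℕ → List V → Set
  Clique k S = ∃ λ c → length c ≡ k × AllPairs (E G) c × All (_∈ S) c

  clique-mono : ∀ {k S S′} → (∀ {u} → u ∈ S → u ∈ S′) → Clique k S → Clique k S′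
  clique-mono S⊆S′ (c , len , pairs , c⊆S) = c , len , pairs , All.map S⊆S′ c⊆S

  clique-cone : ∀ {k u S} → u ∈ S → Clique k (filter (E? u) S) → Clique (suc k) S
  clique-cone {u = u} {S} u∈S (c , len , pairs , c⊆N) =
    u ∷ c , cong suc len ,
    All.map (proj₂ ∘ ∈-filter⁻ (E? u) {xs = S}) c⊆N ∷ pairs ,
    u∈S ∷ All.map (proj₁ ∘ ∈-filter⁻ (E? u)) c⊆N

  clique-tail : ∀ {k u c S} → length c ≡ k → AllPairs (E G) (u ∷ c) → All (_∈ S) c →
    Clique k (filter (E? u) S)
  clique-tail {u = u} len (uc ∷ pairs) c⊆S =
    _ , len , pairs , All.zipWith (λ (e , v∈S) → ∈-filter⁺ (E? u) v∈S e) (uc , c⊆S)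

  -- Exhaustive search: fix the first vertex, then recurse into its neighbourhood. This lets
  -- `saturate` branch constructively.
  clique? : ∀ k S → Dec (Clique k S)
  clique? zero    S = yes ([] , refl , [] , [])
  clique? (suc k) S = map′ to from (any? (λ u → clique? k (filter (E? u) S)) S)
    where
    to = λ found → let _ , u∈S , cl = find found in clique-cone u∈S cl
    from : Clique (suc k) S → _
    from (u ∷ c , len , pairs , u∈S ∷ c⊆S) =
      lose u∈S (clique-tail (cong pred len) pairs c⊆S)

  -- By symmetry of adjacency a clique through `x` can be reordered to start with `x`; irreflexivity
  -- then keeps `x` out of the tail.
  clique-∷⁻ : ∀ {k x S} → Clique (suc k) (x ∷ S) → Clique (suc k) S ⊎ Clique k (filter (E? x) S)
  clique-∷⁻ {x = x} {S} (c , len , pairs , c⊆xS) with any? (x ≟ᶠ_) c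
  ... | no x∉c = inj₁ (c , len , pairs , All.zipWith strip (All.¬Any⇒All¬ c x∉c , c⊆xS))
    where
    strip : ∀ {u} → x ≢ u × u ∈ x ∷ S → u ∈ S
    strip (x≢u , here u≡x)  = contradiction (≡-sym u≡x) x≢u
    strip (_   , there u∈S) = u∈S
  ... | yes x∈c with ∈-∃++ x∈c
  ...   | ys , zs , refl with shift x ys zs
  ...     | c↭ with Permutationₛ.AllPairs-resp-↭ (setoid V) E-sym (resp₂ (E G)) (↭⇒↭ₛ c↭) pairs | All-resp-↭ c↭ c⊆xS
  ...       | pairs′@(xc ∷ _) | _ ∷ c′⊆xS =
    inj₂ (clique-tail (cong pred (trans (≡-sym (↭-length c↭)) len)) pairs′
           (All.zipWith strip (xc , c′⊆xS)))
    where
    strip : ∀ {u} → E G x u × u ∈ x ∷ S → u ∈ S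
    strip (e , here refl)  = contradiction e E-irrefl
    strip (_ , there u∈S) = u∈S

  -- Otherwise `w ∷ c` would be a forbidden clique. This includes `w` in `c`, which misses itself.
  unextendable : ∀ {c w S} → ¬ Clique (suc (length c)) S →
    AllPairs (E G) c → All (_∈ S) c → w ∈ S → 1 ≤ missed w c
  unextendable {c} free pairs c⊆S w∈S = n≢0⇒n>0 λ eq →
    free (_ , refl , missed≡0⇒All c eq ∷ pairs , w∈S ∷ c⊆S)

  -- Greedy pass over `T`: a vertex is moved into `S` unless a `k`-clique among its neighbours in
  -- `S` forbids it. Such a clique survives, as `S` only grows.
  saturate : ∀ {k} S T → ¬ Clique (suc k) S → ∃ λ S′ → ∃ λ T′ →
    S ++ T ↭ S′ ++ T′ × length T′ ≤ length T × length S ≤ length S′ ×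
    (∀ {u} → u ∈ S → u ∈ S′) × ¬ Clique (suc k) S′ ×
    All (λ x → Clique k (filter (E? x) S′)) T′
  saturate S [] free = S , [] , ↭-refl , z≤n , ≤-refl , (λ p → p) , free , []
  saturate {k} S (x ∷ T) free with clique? k (filter (E? x) S)
  ... | yes cl with saturate S T free
  ...   | S′ , T′ , perm , T′≤T , S≤S′ , S⊆S′ , free′ , sat =
    S′ , x ∷ T′ , ↭-trans (shift x S T) (↭-trans (prep x perm) (↭-sym (shift x S′ T′))) ,
    s≤s T′≤T , S≤S′ , S⊆S′ , free′ , clique-mono widen cl ∷ sat
    where
    widen : ∀ {u} → u ∈ filter (E? x) S → u ∈ filter (E? x) S′
    widen u∈ = let u∈S , e = ∈-filter⁻ (E? x) u∈ in ∈-filter⁺ (E? x) (S⊆S′ u∈S) e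
  saturate {k} S (x ∷ T) free | no ¬cl with saturate (x ∷ S) T free-x
    where
    free-x : ¬ Clique (suc k) (x ∷ S)
    free-x cl with clique-∷⁻ cl
    ... | inj₁ cl′ = free cl′
    ... | inj₂ cl′ = ¬cl cl′
  ...   | S′ , T′ , perm , T′≤T , S≤S′ , S⊆S′ , free′ , sat =
    S′ , T′ , ↭-trans (shift x S T) perm ,
    m≤n⇒m≤1+n T′≤T , <⇒≤ S≤S′ , S⊆S′ ∘ there , free′ , sat

  -- Cliques split into a core `K` and a wing `A` under an apex `x`.

  record Wing (S K : List V) (x : V) (A : List V) : Set where
    field
      pairs  : AllPairs (E G) A
      joined : All (λ a → All (E G a) K) A
      apex-A : All (E G x) A
      apex-K : All (E G x) K
      inside : All (_∈ S) A

  module _ {S K x A} (wing : Wing S K x A) (pairs-K : AllPairs (E G) K) (K⊆S : All (_∈ S) K) where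
    open Wing wing

    wing-clique : AllPairs (E G) (A ++ K)
    wing-clique = AllPairs.++⁺ pairs pairs-K joined

    wing-missed : ∀ {w} → ¬ Clique (suc (length A + length K)) S → w ∈ S →
      1 ≤ missed w A + missed w K
    wing-missed {w} free w∈S = subst (1 ≤_) (sumOver-++ _ A K)
      (unextendable (subst (λ k → ¬ Clique (suc k) S) (≡-sym (length-++ A)) free)
        wing-clique (All.++⁺ inside K⊆S) w∈S)

    -- The apex joins the clique here, so the ambient list is `W`. This serves the vertices of `T`,
    -- while `wing-missed` serves those of `S`.
    apex-missed : ∀ {W w} → ¬ Clique (2 + (length A + length K)) W →
      (∀ {u} → u ∈ S → u ∈ W) → x ∈ W → w ∈ W →
      1 ≤ missed w (x ∷ A) + missed w K
    apex-missed {W} {w} free S⊆W x∈W w∈W = subst (1 ≤_) (sumOver-++ _ (x ∷ A) K)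
      (unextendable {x ∷ A ++ K} (subst (λ k → ¬ Clique (2 + k) W) (≡-sym (length-++ A)) free)
        (All.++⁺ apex-A apex-K ∷ wing-clique)
        (x∈W ∷ All.map S⊆W (All.++⁺ inside K⊆S)) w∈W)

  -- Once `w` enters the core, only its neighbours in `A` are still joined to the whole core.
  wing-narrow : ∀ {S K x A w} → Wing S K x A → E G w x → Wing S (w ∷ K) x (filter (E? w) A)
  wing-narrow {A = A} {w} wing wx = record
    { pairs  = AllPairs.filter⁺ (E? w) pairs
    ; joined = All.zipWith (λ (e , es) → E-sym e ∷ es) (All.all-filter (E? w) A , All.filter⁺ (E? w) joined)
    ; apex-A = All.filter⁺ (E? w) apex-A
    ; apex-K = E-sym wx ∷ apex-K
    ; inside = All.filter⁺ (E? w) inside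
    }
    where open Wing wing

  -- With r = p + 1, S = N(v) for v of maximum degree and s = n − δ, these are
  -- the two alternatives of the degree condition, freed of subtraction.
  Dense : ℕ → ℕ → List V → List V → List V → Set
  Dense p s W S T = (3 * p + 1) * s + length T < 3 * length W ⊎ p * s ≤ length S

  Colourable : ℕ → List V → Set
  Colourable k W = Σ (V → Fin k) λ c → ∀ {u v} → u ∈ W → v ∈ W → E G u v → c u ≢ c v

  -- Independence of the vertices left outside a saturated `S`.

  module _ {p s W S T}
    (W↭ : W ↭ S ++ T)
    (free-S : ¬ Clique (suc p) S) (free-W : ¬ Clique (2 + p) W)
    (few : ∀ {u} → u ∈ W → missed u W ≤ s) where

    private
      S⊆W : ∀ {u} → u ∈ S → u ∈ W
      S⊆W = ∈-resp-↭ (↭-sym W↭) ∘ ∈-++⁺ˡ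

      T⊆W : ∀ {u} → u ∈ T → u ∈ W
      T⊆W = ∈-resp-↭ (↭-sym W↭) ∘ ∈-++⁺ʳ S

      |W| : length W ≡ length S + length T
      |W| = trans (↭-length W↭) (length-++ S)

      -- Counted from the side of `L`, each entry contributes at most `s` by `few`.
      missed-total : ∀ L → All (_∈ W) L →
        sumOver (λ w → missed w L) S + sumOver (λ w → missed w L) T ≤ length L * s
      missed-total L L⊆W = begin
        sumOver (λ w → missed w L) S + sumOver (λ w → missed w L) T  ≡⟨ sumOver-++ _ S T ⟨
        sumOver (λ w → missed w L) (S ++ T)                          ≡⟨ sumOver-↭ _ W↭ ⟨
        sumOver (λ w → missed w L) W                                 ≡⟨ missed-swap L W ⟩
        sumOver (λ u → missed u W) L                                 ≤⟨ sumOver-≤ (All.map few L⊆W) ⟩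
        length L * s                                                 ∎
        where open ≤-Reasoning

    large-S⇒no-edge : p * s ≤ length S → ∀ {x y} → x ∈ T → y ∈ T → E G x y →
      ¬ Clique p (filter (E? x) S)
    large-S⇒no-edge ps≤S {x} {y} x∈T y∈T xy (c , refl , pairs , c⊆N) = <-irrefl refl (begin-strict
      length S                                                     <⟨ n<1+n _ ⟩
      suc (length S)                                               ≡⟨ +-comm 1 _ ⟩
      length S + 1                                                 ≡⟨ cong (_+ 1) (*-identityʳ (length S)) ⟨
      length S * 1 + 1                                             ≤⟨ +-mono-≤
        (sumOver-≥ (All.tabulate (unextendable free-S pairs c⊆S)))
        (≤-trans y-misses (sumOver-∈ _ y∈T)) ⟩
      sumOver (λ w → missed w c) S + sumOver (λ w → missed w c) T  ≤⟨ missed-total c (All.map S⊆W c⊆S) ⟩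
      length c * s                                                 ≤⟨ ps≤S ⟩
      length S                                                     ∎)
      where
      open ≤-Reasoning
      c⊆S : All (_∈ S) c
      c⊆S = All.map (proj₁ ∘ ∈-filter⁻ (E? x)) c⊆N
      x-c : All (E G x) c
      x-c = All.map (proj₂ ∘ ∈-filter⁻ (E? x) {xs = S}) c⊆N
      -- `y` cannot extend the clique `x ∷ c`, and it is adjacent to `x`, so what it misses lies in
      -- `c`.
      y-misses : 1 ≤ missed y c
      y-misses = subst (λ b → 1 ≤ (if b then 0 else 1) + missed y c) (E-sym xy)
        (unextendable {x ∷ c} free-W (x-c ∷ pairs) (T⊆W x∈T ∷ All.map S⊆W c⊆S) (T⊆W y∈T))

    module _ (dense : (3 * p + 1) * s + length T < 3 * length W)
             {x y} (x∈T : x ∈ T) (y∈T : y ∈ T) (xy : E G x y) where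

      -- Repeating K three times gives its vertices weight 3.
      support : List V → List V → List V → List V
      support K A B = K ++ K ++ K ++ (x ∷ A) ++ (y ∷ B)

      missed-support : ∀ w K A B → missed w (support K A B) ≡
        3 * missed w K + (missed w (x ∷ A) + missed w (y ∷ B))
      missed-support w K A B
        rewrite sumOver-++ (λ u → if adj G w u then 0 else 1) K (K ++ K ++ (x ∷ A) ++ (y ∷ B))
              | sumOver-++ (λ u → if adj G w u then 0 else 1) K (K ++ (x ∷ A) ++ (y ∷ B))
              | sumOver-++ (λ u → if adj G w u then 0 else 1) K ((x ∷ A) ++ (y ∷ B))
              | sumOver-++ (λ u → if adj G w u then 0 else 1) (x ∷ A) (y ∷ B)
        = triple (missed w K) _
        where
        triple : ∀ k r → k + (k + (k + r)) ≡ 3 * k + r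
        triple = solve-∀

      -- With `k = length K` the support has `3 * k + 2 * m + 4` entries, which is `m` short of
      -- `3 * p + 1`.
      length-support : ∀ K A B m → length A ≡ suc m → length B ≡ suc m → suc m + length K ≡ p →
        length (support K A B) ≤ 3 * p + 1
      length-support K A B m |A| |B| refl
        rewrite length-++ K {K ++ K ++ (x ∷ A) ++ (y ∷ B)}
              | length-++ K {K ++ (x ∷ A) ++ (y ∷ B)}
              | length-++ K {(x ∷ A) ++ (y ∷ B)}
              | length-++ (x ∷ A) {y ∷ B} | |A| | |B|
        = ≤-trans (m≤n+m _ m) (≤-reflexive (identity (length K) m))
        where
        identity : ∀ k m → m + (k + (k + (k + (suc (suc m) + suc (suc m))))) ≡ 3 * (suc m + k) + 1
        identity = solve-∀

      -- Descent on m = |A| = |B|: a vertex of S missing weight at most 2 of the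
      -- support can be moved into K, at the cost of one vertex of A and one of B.
      no-wings : ∀ m {K A B} → length A ≡ m → length B ≡ m → m + length K ≡ p →
        AllPairs (E G) K → All (_∈ S) K → ¬ (Wing S K x A × Wing S K y B)
      no-wings zero {K} _ _ |K| pairs-K K⊆S (wing-x , wing-y) =
        -- With both wings empty, `K` has `p` vertices and forms a forbidden clique with `x` and
        -- `y`.
        free-W (x ∷ y ∷ K , cong (2 +_) |K| ,
          (xy ∷ Wing.apex-K wing-x) ∷ Wing.apex-K wing-y ∷ pairs-K ,
          T⊆W x∈T ∷ T⊆W y∈T ∷ All.map S⊆W K⊆S)
      no-wings (suc m) {K} {A} {B} |A| |B| |K| pairs-K K⊆S (wing-x , wing-y)
        with all? (λ w → 3 ≤? missed w (support K A B)) S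
      -- Weight 3 is missed from `S` but only 2 is guaranteed from `T`; the shortfall from
      -- `3 * length W` is the term `length T` in `dense`.
      ... | yes heavy = <⇒≱ dense (begin
        3 * length W                                         ≡⟨ cong (3 *_) |W| ⟩
        3 * (length S + length T)                            ≡⟨ regroup (length S) (length T) ⟩
        (length S * 3 + length T * 2) + length T             ≤⟨ +-monoˡ-≤ (length T)
          (+-mono-≤ (sumOver-≥ heavy) (sumOver-≥ (All.tabulate T-misses))) ⟩
        (sumOver (λ w → missed w (support K A B)) S +
         sumOver (λ w → missed w (support K A B)) T) + length T
                                                             ≤⟨ +-monoˡ-≤ (length T) (missed-total _ support⊆W) ⟩
        length (support K A B) * s + length T                ≤⟨ +-monoˡ-≤ (length T)
          (*-monoˡ-≤ s (length-support K A B m |A| |B| |K|)) ⟩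
        (3 * p + 1) * s + length T                           ∎)
        where
        open ≤-Reasoning
        regroup : ∀ a b → 3 * (a + b) ≡ (a * 3 + b * 2) + b
        regroup = solve-∀
        support⊆W : All (_∈ W) (support K A B)
        support⊆W =
          let K⊆W = All.map S⊆W K⊆S in
          All.++⁺ K⊆W (All.++⁺ K⊆W (All.++⁺ K⊆W (All.++⁺
            (T⊆W x∈T ∷ All.map S⊆W (Wing.inside wing-x))
            (T⊆W y∈T ∷ All.map S⊆W (Wing.inside wing-y)))))
        -- One missed vertex of `K` already counts three times; if there is none, each side
        -- contributes at least one.
        two : ∀ {k a b} → 1 ≤ a + k → 1 ≤ b + k → 2 ≤ 3 * k + (a + b)
        two {zero}  {a} {b} a≥1 b≥1 =
          +-mono-≤ (subst (1 ≤_) (+-identityʳ a) a≥1) (subst (1 ≤_) (+-identityʳ b) b≥1)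
        two {suc k} _ _ =
          ≤-trans (≤-trans (s≤s (s≤s z≤n)) (*-monoʳ-≤ 3 (s≤s (z≤n {k})))) (m≤m+n _ _)
        free-side : ∀ (L : List V) → length L ≡ suc m → ¬ Clique (2 + (length L + length K)) W
        free-side L |L| = subst (λ k → ¬ Clique (2 + k) W)
          (≡-sym (trans (cong (_+ length K) |L|) |K|)) free-W
        T-misses : ∀ {w} → w ∈ T → 2 ≤ missed w (support K A B)
        T-misses {w} w∈T = subst (2 ≤_) (≡-sym (missed-support w K A B))
          (two {missed w K}
            (apex-missed wing-x pairs-K K⊆S (free-side A |A|) S⊆W (T⊆W x∈T) (T⊆W w∈T))
            (apex-missed wing-y pairs-K K⊆S (free-side B |B|) S⊆W (T⊆W y∈T) (T⊆W w∈T)))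
      ... | no ¬heavy with find (All.¬All⇒Any¬ (λ w → 3 ≤? missed w (support K A B)) S ¬heavy)
      ...   | w , w∈S , light =
        -- If `w` lies in `A` or `B`, it is itself the vertex missed there, so it leaves that wing
        -- as it enters the core.
        no-wings m (shrink A |A| A-misses) (shrink B |B| B-misses)
          (trans (+-suc m (length K)) |K|)
          (missed≡0⇒All K K-misses ∷ pairs-K) (w∈S ∷ K⊆S)
          (wing-narrow wing-x (adjacent x x-misses) , wing-narrow wing-y (adjacent y y-misses))
        where
        non : V → ℕ
        non u = if adj G w u then 0 else 1
        free-side : ∀ (L : List V) → length L ≡ suc m → ¬ Clique (suc (length L + length K)) S
        free-side L |L| = subst (λ k → ¬ Clique (suc k) S)
          (≡-sym (trans (cong (_+ length K) |L|) |K|)) free-S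
        -- Missing any of `K` costs 3, so `k` is 0. Each wing then costs at least 1, which exhausts
        -- the allowance of 2 and leaves nothing for the apexes.
        sharp : ∀ k a b i j → 1 ≤ a + k → 1 ≤ b + k → ¬ (3 ≤ 3 * k + ((i + a) + (j + b))) →
          k ≡ 0 × a ≡ 1 × b ≡ 1 × i ≡ 0 × j ≡ 0
        sharp zero (suc a) (suc b) i j _ _ small =
          refl , cong suc (m+n≡0⇒n≡0 i i+a≡0) , cong suc (m+n≡0⇒n≡0 j j+b≡0) ,
          m+n≡0⇒m≡0 i i+a≡0 , m+n≡0⇒m≡0 j j+b≡0
          where
          regroup : ∀ i a j b → (i + suc a) + (j + suc b) ≡ 2 + ((i + a) + (j + b))
          regroup = solve-∀
          rest≡0 : (i + a) + (j + b) ≡ 0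
          rest≡0 = n<1⇒n≡0 (s≤s⁻¹ (s≤s⁻¹ (subst (_< 3) (regroup i a j b) (≰⇒> small))))
          i+a≡0 : i + a ≡ 0
          i+a≡0 = m+n≡0⇒m≡0 (i + a) rest≡0
          j+b≡0 : j + b ≡ 0
          j+b≡0 = m+n≡0⇒n≡0 (i + a) rest≡0
        sharp (suc k) a b i j _ _ small = contradiction
          (≤-trans (*-monoʳ-≤ 3 (s≤s (z≤n {k}))) (m≤m+n _ _)) small
        all-sharp = sharp (missed w K) (missed w A) (missed w B) (non x) (non y)
          (wing-missed wing-x pairs-K K⊆S (free-side A |A|) w∈S)
          (wing-missed wing-y pairs-K K⊆S (free-side B |B|) w∈S)
          (light ∘ subst (3 ≤_) (≡-sym (missed-support w K A B)))
        K-misses = proj₁ all-sharp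
        A-misses = proj₁ (proj₂ all-sharp)
        B-misses = proj₁ (proj₂ (proj₂ all-sharp))
        x-misses = proj₁ (proj₂ (proj₂ (proj₂ all-sharp)))
        y-misses = proj₂ (proj₂ (proj₂ (proj₂ all-sharp)))
        adjacent : ∀ u → non u ≡ 0 → E G w u
        adjacent u eq with adj G w u
        ... | true = refl
        shrink : ∀ L → length L ≡ suc m → missed w L ≡ 1 → length (filter (E? w) L) ≡ m
        shrink L |L| L-misses = +-cancelʳ-≡ 1 _ m (begin-equality
          length (filter (E? w) L) + 1           ≡⟨ cong (length (filter (E? w) L) +_) L-misses ⟨
          length (filter (E? w) L) + missed w L  ≡⟨ length-filter-E w L ⟩
          length L                               ≡⟨ |L| ⟩
          suc m                                  ≡⟨ +-comm 1 m ⟩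
          m + 1                                  ∎)
          where open ≤-Reasoning

      dense⇒no-edge : Clique p (filter (E? x) S) → ¬ Clique p (filter (E? y) S)
      dense⇒no-edge (A , |A| , pairs-A , A⊆N) (B , |B| , pairs-B , B⊆N) =
        -- The descent starts with an empty core and the two full cliques as wings.
        no-wings p {[]} |A| |B| (+-identityʳ p) [] [] (wing pairs-A A⊆N , wing pairs-B B⊆N)
        where
        wing : ∀ {z L} → AllPairs (E G) L → All (_∈ filter (E? z) S) L → Wing S [] z L
        wing {z} pairs L⊆N = record
          { pairs  = pairs
          ; joined = All.map (λ _ → []) L⊆N
          ; apex-A = All.map (proj₂ ∘ ∈-filter⁻ (E? z) {xs = S}) L⊆N
          ; apex-K = []
          ; inside = All.map (proj₁ ∘ ∈-filter⁻ (E? z)) L⊆N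
          }

    no-edge : Dense p s W S T → All (λ z → Clique p (filter (E? z) S)) T →
      ∀ {x y} → x ∈ T → y ∈ T → ¬ E G x y
    no-edge (inj₁ dense) sat x∈T y∈T xy =
      dense⇒no-edge dense x∈T y∈T xy (All.lookup sat x∈T) (All.lookup sat y∈T)
    no-edge (inj₂ ps≤S) sat x∈T y∈T xy =
      large-S⇒no-edge ps≤S x∈T y∈T xy (All.lookup sat x∈T)

    colour-independent : (∀ {x y} → x ∈ T → y ∈ T → ¬ E G x y) →
      ∀ {k} → Colourable k S → Colourable (suc k) W
    colour-independent indep {k} (c , proper) = colour , colour-proper
      where
      colour : V → Fin (suc k)
      colour u with any? (u ≟ᶠ_) T
      ... | yes _ = zero
      ... | no  _ = suc (c u)
      in-S : ∀ {u} → u ∈ W → ¬ u ∈ T → u ∈ S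
      in-S u∈W u∉T with ∈-++⁻ S (∈-resp-↭ W↭ u∈W)
      ... | inj₁ u∈S = u∈S
      ... | inj₂ u∈T = contradiction u∈T u∉T
      colour-proper : ∀ {u v} → u ∈ W → v ∈ W → E G u v → colour u ≢ colour v
      colour-proper {u} {v} u∈W v∈W uv eq with any? (u ≟ᶠ_) T | any? (v ≟ᶠ_) T
      ... | yes u∈T | yes v∈T = indep u∈T v∈T uv
      ... | no  u∉T | no  v∉T = proper (in-S u∈W u∉T) (in-S v∈W v∉T) uv (suc-injective eq)

  -- Induction on the number of colours.

  colourable : ∀ p {s W S T} → W ↭ S ++ T →
    ¬ Clique (suc p) S → ¬ Clique (2 + p) W →
    (∀ {u} → u ∈ W → missed u W ≤ s) → length T ≤ s →
    Dense p s W S T → Colourable (suc p) W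
  -- A list without 2-cliques has no edges, so one colour suffices.
  colourable zero _ _ free-W _ _ _ = (λ _ → zero) , λ u∈W v∈W uv _ →
    free-W (_ , refl , (uv ∷ []) ∷ [] ∷ [] , u∈W ∷ v∈W ∷ [])
  colourable (suc q) {s} {W} {S₀} {T₀} W↭₀ free-S₀ free-W few T₀≤s dense₀
    with saturate S₀ T₀ free-S₀
  ... | S , T , perm , T≤T₀ , S₀≤S , _ , free-S , sat =
    colour-independent W↭ free-S free-W few (no-edge W↭ free-S free-W few dense sat) (colour-S S refl)
    where
    W↭ : W ↭ S ++ T
    W↭ = ↭-trans W↭₀ perm
    |W| : length W ≡ length S + length T
    |W| = trans (↭-length W↭) (length-++ S)
    T≤s : length T ≤ s
    T≤s = ≤-trans T≤T₀ T₀≤s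
    dense : Dense (suc q) s W S T
    dense = Sum.map
      (≤-<-trans (+-monoʳ-≤ ((3 * suc q + 1) * s) T≤T₀)) (λ d → ≤-trans d S₀≤S) dense₀
    few-S : ∀ {u} → u ∈ S → missed u S ≤ s
    few-S {u} u∈S = begin
      missed u S               ≤⟨ m≤m+n _ _ ⟩
      missed u S + missed u T  ≡⟨ sumOver-++ _ S T ⟨
      missed u (S ++ T)        ≡⟨ sumOver-↭ _ W↭ ⟨
      missed u W               ≤⟨ few (∈-resp-↭ (↭-sym W↭) (∈-++⁺ˡ u∈S)) ⟩
      s                        ∎
      where open ≤-Reasoning
    -- In the recursive call `S` replaces `W`, and the neighbours and non-neighbours of `u` in `S`
    -- replace `S` and `T`.
    module _ {u} (u∈S : u ∈ S) where
      N M : List V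
      N = filter (E? u) S
      M = filter (∁? (E? u)) S
      M≤s : length M ≤ s
      M≤s = subst (_≤ s) (≡-sym (length-filter-∁E u S)) (few-S u∈S)
      dense-S : Dense q s S N M
      dense-S with dense
      -- Cancelling `T` and using `length T ≤ s` gives `(3 * q + 2) * s < 3 * length S`; one of
      -- these `s` pays for `length M`.
      ... | inj₁ d = inj₁ (+-cancelʳ-< (2 * s + 3 * length T) _ _ (begin-strict
        (3 * q + 1) * s + length M + (2 * s + 3 * length T)
          ≤⟨ +-monoˡ-≤ _ (+-monoʳ-≤ ((3 * q + 1) * s) M≤s) ⟩
        (3 * q + 1) * s + s + (2 * s + 3 * length T)
          ≡⟨ regroup₁ q s (length T) ⟩
        (3 * suc q + 1) * s + length T + 2 * length T
          <⟨ +-mono-<-≤ d (*-monoʳ-≤ 2 T≤s) ⟩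
        3 * length W + 2 * s
          ≡⟨ cong (λ z → 3 * z + 2 * s) |W| ⟩
        3 * (length S + length T) + 2 * s
          ≡⟨ regroup₂ (length S) (length T) s ⟩
        3 * length S + (2 * s + 3 * length T) ∎))
        where
        open ≤-Reasoning
        regroup₁ : ∀ q s t → (3 * q + 1) * s + s + (2 * s + 3 * t) ≡ (3 * suc q + 1) * s + t + 2 * t
        regroup₁ = solve-∀
        regroup₂ : ∀ a t s → 3 * (a + t) + 2 * s ≡ 3 * a + (2 * s + 3 * t)
        regroup₂ = solve-∀
      -- Passing to `N` loses at most `s` vertices, exactly one step of the factor `suc q`.
      ... | inj₂ d = inj₂ (+-cancelʳ-≤ s _ _ (begin
        q * s + s              ≡⟨ +-comm (q * s) s ⟩
        suc q * s              ≤⟨ d ⟩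
        length S               ≡⟨ length-filter-E u S ⟨
        length N + missed u S  ≤⟨ +-monoʳ-≤ (length N) (few-S u∈S) ⟩
        length N + s           ∎))
        where open ≤-Reasoning
      colour-from : Colourable (suc q) S
      colour-from = colourable q (filter-∁-↭ (E? u) S) (free-S ∘ clique-cone u∈S) free-S few-S M≤s dense-S
    -- A nonempty `S` supplies its head as the vertex `u`.
    colour-S : ∀ S′ → S′ ≡ S → Colourable (suc q) S
    colour-S []      refl = (λ _ → zero) , λ ()
    colour-S (u ∷ _) refl = colour-from (here refl)

  -- Cliques as lists and as injections from `Fin k`.

  lookup-E : ∀ {c} → AllPairs (E G) c → ∀ i j → i ≢ j → E G (lookup c i) (lookup c j)
  lookup-E (_  ∷ _)     zero    zero    i≢j = contradiction refl i≢j
  lookup-E (xc ∷ _)     zero    (suc j) _   = All.lookup xc (∈-lookup j)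
  lookup-E (xc ∷ _)     (suc i) zero    _   = E-sym (All.lookup xc (∈-lookup i))
  lookup-E (_  ∷ pairs) (suc i) (suc j) i≢j = lookup-E pairs i j (i≢j ∘ cong suc)

  cliqueFree⇒¬Clique : ∀ {k} → CliqueFree G k → ∀ {W} → ¬ Clique k W
  cliqueFree⇒¬Clique free (c , refl , pairs , _) = free (lookup c , injective , lookup-E pairs)
    where
    injective : ∀ {i j} → lookup c i ≡ lookup c j → i ≡ j
    injective {i} {j} eq with i ≟ᶠ j
    ... | yes i≡j = i≡j
    ... | no  i≢j = contradiction (subst (E G (lookup c i)) (≡-sym eq) (lookup-E pairs i j i≢j)) E-irrefl

-- Translating the degree condition.

module _ {n : ℕ} (G : Graph (suc n)) where

  private
    W : List (Fin (suc n))
    W = allFin (suc n)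

    δ Δ : ℕ
    δ = minDegree G
    Δ = maxDegree G

  degree+missed-all : ∀ u → degree G u + missed G u W ≡ suc n
  degree+missed-all u = trans (degree+missed G u W) (length-tabulate (λ i → i))

  -- Here `r = q + 2`, so `3 * q + 2`, `3 * q + 4` and `suc q` stand for `3r - 4`, `3r - 2` and
  -- `r - 1`. Exceeding a minimum means exceeding one of its two terms, whence the disjunction, with
  -- denominators cleared.
  partite : ∀ q → CliqueFree G (3 + q) →
    ((3 * q + 2) * suc n < (3 * q + 4) * δ + Δ ⊎ suc q * suc n ≤ suc q * δ + Δ) →
    Partite G (2 + q)
  partite q free dense₀ with foldr-⊔-attained zero (degree G) W
  ... | v , Δ≤degree =
    let c , proper = colourable G (suc q) (filter-∁-↭ (E? G v) W)
                       (free-W ∘ clique-cone G (∈-allFin v)) free-W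
                       (λ {u} _ → missed≤s u)
                       (subst (_≤ s) (≡-sym |T|) (missed≤s v)) dense
    in c , λ x y → proper (∈-allFin x) (∈-allFin y)
    where
    S T : List (Fin (suc n))
    S = filter (E? G v) W
    T = filter (∁? (E? G v)) W
    d t s : ℕ
    d = degree G v
    t = missed G v W
    s = suc n ∸ δ
    free-W : ¬ Clique G (3 + q) W
    free-W = cliqueFree⇒¬Clique G free
    δ≤degree : ∀ u → δ ≤ degree G u
    δ≤degree u = foldr-⊓-≤ (degree G) _ (∈-allFin u)
    |W| : length W ≡ suc n
    |W| = length-tabulate (λ i → i)
    |T| : length T ≡ t
    |T| = length-filter-∁E G v W
    |S| : length S ≡ d
    |S| = +-cancelʳ-≡ t _ _
      (trans (length-filter-E G v W) (trans |W| (≡-sym (degree+missed-all v))))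
    -- The truncated subtraction in `s` is exact, since `δ` is at most a degree and hence at most
    -- `suc n`.
    δ+s : δ + s ≡ suc n
    δ+s = m+[n∸m]≡n (≤-trans (δ≤degree zero) (m+n≤o⇒m≤o _ (≤-reflexive (degree+missed-all zero))))
    open ≤-Reasoning
    missed≤s : ∀ u → missed G u W ≤ s
    missed≤s u = +-cancelˡ-≤ δ _ _ (begin
      δ + missed G u W           ≤⟨ +-monoˡ-≤ _ (δ≤degree u) ⟩
      degree G u + missed G u W  ≡⟨ degree+missed-all u ⟩
      suc n                      ≡⟨ δ+s ⟨
      δ + s                      ∎)
    regroup : ∀ q δ s t d → (3 * suc q + 1) * s + t + ((3 * q + 4) * δ + d) ≡ (3 * q + 4) * (δ + s) + (d + t)
    regroup = solve-∀
    split : ∀ q n → (3 * q + 4) * n + n ≡ 3 * n + (3 * q + 2) * n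
    split = solve-∀
    dense : Dense G (suc q) s W S T
    dense = Sum.map
      (λ h → subst₂ (λ a b → (3 * suc q + 1) * s + a < 3 * b) (≡-sym |T|) (≡-sym |W|)
        -- The added term completes `s` and `t` to `suc n`, via `δ + s` and `d + t`.
        (+-cancelʳ-< ((3 * q + 4) * δ + d) _ _ (begin-strict
          (3 * suc q + 1) * s + t + ((3 * q + 4) * δ + d)  ≡⟨ regroup q δ s t d ⟩
          (3 * q + 4) * (δ + s) + (d + t)                  ≡⟨ cong₂ (λ a b → (3 * q + 4) * a + b)
                                                                δ+s (degree+missed-all v) ⟩
          (3 * q + 4) * suc n + suc n                      ≡⟨ split q (suc n) ⟩
          3 * suc n + (3 * q + 2) * suc n                  <⟨ +-monoʳ-< (3 * suc n) h ⟩
          3 * suc n + ((3 * q + 4) * δ + Δ)                ≤⟨ +-monoʳ-≤ (3 * suc n)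
                                                                (+-monoʳ-≤ ((3 * q + 4) * δ) Δ≤degree) ⟩
          3 * suc n + ((3 * q + 4) * δ + d)                ∎)))
      (λ h → subst (suc q * s ≤_) (≡-sym |S|) (+-cancelˡ-≤ (suc q * δ) _ _ (begin
        suc q * δ + suc q * s  ≡⟨ *-distribˡ-+ (suc q) δ s ⟨
        suc q * (δ + s)        ≡⟨ cong (suc q *_) δ+s ⟩
        suc q * suc n          ≤⟨ h ⟩
        suc q * δ + Δ          ≤⟨ +-monoʳ-≤ (suc q * δ) Δ≤degree ⟩
        suc q * δ + d          ∎)))
      dense₀

theorem1p3 : (r : ℕ) → 2 ≤ r → (n : ℕ) → (G : Graph n) →
    CliqueFree G (r + 1) →
    ((3 * r ∸ 4) * n < (3 * r ∸ 2) * minDegree G + maxDegree G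
    ⊎ (r ∸ 1) * n < (r ∸ 1) * minDegree G + maxDegree G + 1) →
    Partite G r
-- The graph without vertices is separate because a vertex of maximum degree has to exist.
theorem1p3 (suc (suc q)) _ zero G _ _ = (λ ()) , λ ()
theorem1p3 1 (s≤s ()) _ _ _ _
theorem1p3 (suc (suc q)) _ (suc n) G free dense =
  partite G q (subst (CliqueFree G) (+-comm (2 + q) 1) free) dense′
  where
  3r∸4 : 3 * (2 + q) ∸ 4 ≡ 3 * q + 2
  3r∸4 = trans (cong (_∸ 4) (expand q)) (m+n∸m≡n 4 _)
    where
    expand : ∀ q → 3 * (2 + q) ≡ 4 + (3 * q + 2)
    expand = solve-∀
  3r∸2 : 3 * (2 + q) ∸ 2 ≡ 3 * q + 4
  3r∸2 = trans (cong (_∸ 2) (expand q)) (m+n∸m≡n 2 _)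
    where
    expand : ∀ q → 3 * (2 + q) ≡ 2 + (3 * q + 4)
    expand = solve-∀
  dense′ : (3 * q + 2) * suc n < (3 * q + 4) * minDegree G + maxDegree G
         ⊎ suc q * suc n ≤ suc q * minDegree G + maxDegree G
  dense′ = Sum.map
    (subst₂ (λ a b → a * suc n < b * minDegree G + maxDegree G) 3r∸4 3r∸2)
    -- The `+ 1` on the right turns the strict inequality into a weak one.
    (s≤s⁻¹ ∘ subst (suc q * suc n <_) (+-comm _ 1))
    dense
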